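{- Let $q\ge 2$ be a prime power and $N\ge 2$ an integer. Fix a polynomial $A\in\mathcal{M}_N$. For any integers $0\le h\le N-1$ and $d\ge 0$, $$\big|\{F\in\mathcal{M}_N:\ \deg(F-A)\le h,\ P^+(F)\le d\}\big|\ \le\ \big|\{F\in\mathcal{M}_{h+1}:\ P^+(F)\le d\}\big|.$$
   Context: $\mathcal{M}_n$ is the set of monic polynomials of degree $n$ in $\mathbb{F}_q[t]$, and $P^+(F):=\max\{\deg P: P\mid F,\ P\text{ monic irreducible}\}$. The zero polynomial is regarded as having degree $\le h$ for every $h$. -}

module Defs where

open import Algebra.Bundles using (CommutativeRing)
open import Algebra.Bundles.Raw using (RawSemiring)
open import Algebra.Structures using (IsCommutativeRing)
import Algebra.Definitions.RawSemiring as RawSemiringDefs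
import Algebra.Definitions.RawMagma as RawMagmaDefs
open import Data.Fin.Base using (Fin)
import Data.Fin.Properties as Fin
open import Data.List.Base
  using (List; []; _∷_; _++_; map; filter; concatMap; upTo; allFin; cartesianProductWith)
open import Data.List.Properties using (∷-injective; ++-cancelʳ; ++-identityʳ)
open import Data.List.Extrema.Nat using (max; xs≤max; argmax-sel)
open import Data.List.Membership.Propositional using (_∈_; lose; find)
open import Data.List.Membership.Propositional.Properties
  using ( ∈-map⁺; ∈-map⁻; ∈-filter⁺; ∈-filter⁻; ∈-upTo⁺; ∈-allFin
        ; ∈-concatMap⁺; ∈-concatMap⁻; ∈-cartesianProductWith⁺; ∈-cartesianProductWith⁻)
open import Data.List.Relation.Unary.All as All using ([])
open import Data.List.Relation.Unary.Any using (any?; here)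
open import Data.List.Relation.Unary.AllPairs using ([]; _∷_)
open import Data.List.Relation.Unary.Unique.Propositional using (Unique)
import Data.List.Relation.Unary.Unique.Propositional.Properties as Unique
open import Data.Nat.Base as ℕ using (ℕ; zero; suc; _≤_; _<_; z≤n; s≤s)
import Data.Nat.Properties as ℕ
open import Data.Nat.Primality using (Prime)
open import Data.Product.Base using (∃-syntax; _×_; _,_; proj₁; proj₂)
open import Data.Sum.Base using (_⊎_; inj₁; inj₂; [_,_]′; reduce)
open import Function.Base using (_∘_; id)
open import Function.Bundles using (_↔_; Inverse)
open import Level using (0ℓ)
open import Relation.Binary.Definitions using (DecidableEquality)
open import Relation.Binary.PropositionalEquality
open import Relation.Nullary using (¬_; Dec; yes; no; contradiction)
open import Relation.Nullary.Decidable using (map′; _×-dec_; ¬?)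

IsPrimePower : ℕ → Set
IsPrimePower q = ∃[ p ] ∃[ k ] Prime p × 1 ≤ k × q ≡ p ℕ.^ k

record FiniteField (q : ℕ) : Set₁ where
  infixl 6 _+ᶠ_
  infixl 7 _*ᶠ_
  infix  8 -ᶠ_
  field
    Carrier           : Set
    _+ᶠ_ _*ᶠ_         : Carrier → Carrier → Carrier
    -ᶠ_               : Carrier → Carrier
    0ᶠ 1ᶠ             : Carrier
    isCommutativeRing : IsCommutativeRing _≡_ _+ᶠ_ _*ᶠ_ -ᶠ_ 0ᶠ 1ᶠ
    0≢1               : 0ᶠ ≢ 1ᶠ
    inverse           : ∀ x → x ≢ 0ᶠ → ∃[ y ] x *ᶠ y ≡ 1ᶠ
    enumeration       : Carrier ↔ Fin q

  commutativeRing : CommutativeRing 0ℓ 0ℓ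
  commutativeRing = record { isCommutativeRing = isCommutativeRing }

module Polynomials {q : ℕ} (𝔽 : FiniteField q) where
  open FiniteField 𝔽 renaming (Carrier to K)
  private module K = CommutativeRing commutativeRing

  -- Coefficients from the constant term upwards; trailing zeros are allowed,
  -- so polynomials are compared with _≈_, never with _≡_.
  Poly : Set
  Poly = List K

  coeff : Poly → ℕ → K
  coeff []      _       = 0ᶠ
  coeff (a ∷ p) zero    = a
  coeff (a ∷ p) (suc i) = coeff p i

  infix 4 _≈_ _≈?_ _≟ᶠ_
  _≈_ : Poly → Poly → Set
  p ≈ r = ∀ i → coeff p i ≡ coeff r i

  infixl 6 _+_ _-_
  infixl 7 _*_
  infixr 7 _·_
  infix  8 -_

  _+_ : Poly → Poly → Poly
  []      + r       = r
  (a ∷ p) + []      = a ∷ p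
  (a ∷ p) + (b ∷ r) = a +ᶠ b ∷ p + r

  -_ : Poly → Poly
  - p = map -ᶠ_ p

  _-_ : Poly → Poly → Poly
  p - r = p + (- r)

  _·_ : K → Poly → Poly
  a · p = map (a *ᶠ_) p

  _*_ : Poly → Poly → Poly
  []      * r = []
  (a ∷ p) * r = a · r + (0ᶠ ∷ p * r)

  rawSemiring : RawSemiring 0ℓ 0ℓ
  rawSemiring = record
    { Carrier = Poly ; _≈_ = _≈_ ; _+_ = _+_ ; _*_ = _*_ ; 0# = [] ; 1# = 1ᶠ ∷ [] }

  open RawSemiringDefs rawSemiring public using (_∣_; _∤_; Irreducible; mkIrred)

  _≟ᶠ_ : DecidableEquality K
  x ≟ᶠ y = map′ (λ e → trans (sym (strictlyInverseʳ x)) (trans (cong from e) (strictlyInverseʳ y)))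
                (cong to) (to x Fin.≟ to y)
    where open Inverse enumeration

  private
    ≈-cons : ∀ {p r} → coeff p 0 ≡ coeff r 0 → (∀ i → coeff p (suc i) ≡ coeff r (suc i)) → p ≈ r
    ≈-cons e es zero    = e
    ≈-cons e es (suc i) = es i

  _≈?_ : ∀ p r → Dec (p ≈ r)
  []      ≈? []      = yes λ _ → refl
  []      ≈? (b ∷ r) = map′ (λ (e , es) → ≈-cons {[]} {b ∷ r} e es) (λ e → e 0 , e ∘ suc)
                            (0ᶠ ≟ᶠ b ×-dec [] ≈? r)
  (a ∷ p) ≈? []      = map′ (λ (e , es) → ≈-cons {a ∷ p} {[]} e es) (λ e → e 0 , e ∘ suc)
                            (a ≟ᶠ 0ᶠ ×-dec p ≈? [])
  (a ∷ p) ≈? (b ∷ r) = map′ (λ (e , es) → ≈-cons {a ∷ p} {b ∷ r} e es) (λ e → e 0 , e ∘ suc)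
                            (a ≟ᶠ b ×-dec p ≈? r)

  open RawMagmaDefs (RawSemiring.*-rawMagma rawSemiring) public
    using () renaming (_,_ to infixr 4 _∣-,_)

  -- deg 0 = 0, so that deg p ≤ h holds for p = 0 and every h.
  deg : Poly → ℕ
  deg []      = 0
  deg (a ∷ p) with p ≈? []
  ... | yes _ = 0
  ... | no  _ = suc (deg p)

  Monic : ℕ → Poly → Set
  Monic n p = deg p ≡ n × coeff p n ≡ 1ᶠ

  elements : List K
  elements = map (Inverse.from enumeration) (allFin q)

  tuples : ℕ → List Poly
  tuples zero    = [] ∷ []
  tuples (suc n) = cartesianProductWith _∷_ elements (tuples n)

  -- One representative of each monic polynomial of degree n
  -- (see 𝓜-sound, 𝓜-complete, 𝓜-unique and 𝓜-distinct).
  𝓜 : ℕ → List Poly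
  𝓜 n = map (_++ 1ᶠ ∷ []) (tuples n)

  private
    ≈-sym : ∀ {p r} → p ≈ r → r ≈ p
    ≈-sym e i = sym (e i)

    ≈-trans : ∀ {p r s} → p ≈ r → r ≈ s → p ≈ s
    ≈-trans e f i = trans (e i) (f i)

  coeff-+ : ∀ p r i → coeff (p + r) i ≡ coeff p i +ᶠ coeff r i
  coeff-+ []      r       i       = sym (K.+-identityˡ _)
  coeff-+ (a ∷ p) []      i       = sym (K.+-identityʳ _)
  coeff-+ (a ∷ p) (b ∷ r) zero    = refl
  coeff-+ (a ∷ p) (b ∷ r) (suc i) = coeff-+ p r i

  coeff-· : ∀ a p i → coeff (a · p) i ≡ a *ᶠ coeff p i
  coeff-· a []      i       = sym (K.zeroʳ a)
  coeff-· a (b ∷ p) zero    = refl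
  coeff-· a (b ∷ p) (suc i) = coeff-· a p i

  coeff-∷* : ∀ a p r i → coeff ((a ∷ p) * r) i ≡ a *ᶠ coeff r i +ᶠ coeff (0ᶠ ∷ p * r) i
  coeff-∷* a p r i = trans (coeff-+ (a · r) _ i) (cong (_+ᶠ _) (coeff-· a r i))

  ∷-cong : ∀ {a b p r} → a ≡ b → p ≈ r → (a ∷ p) ≈ (b ∷ r)
  ∷-cong e es zero    = e
  ∷-cong e es (suc i) = es i

  private
    0∷≈0 : ∀ {p} → p ≈ [] → (0ᶠ ∷ p) ≈ []
    0∷≈0 e zero    = refl
    0∷≈0 e (suc i) = e i

  *-congʳ : ∀ p {r s} → r ≈ s → p * r ≈ p * s
  *-congʳ []      e i = refl
  *-congʳ (a ∷ p) {r} {s} e i =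
    trans (coeff-∷* a p r i)
      (trans (cong₂ _+ᶠ_ (cong (a *ᶠ_) (e i)) (∷-cong refl (*-congʳ p e) i))
        (sym (coeff-∷* a p s i)))

  *-zeroˡ : ∀ {p} r → p ≈ [] → p * r ≈ []
  *-zeroˡ {[]}    r e i = refl
  *-zeroˡ {a ∷ p} r e i =
    trans (coeff-∷* a p r i)
      (trans (cong₂ _+ᶠ_ (trans (cong (_*ᶠ _) (e 0)) (K.zeroˡ _))
                         (0∷≈0 (*-zeroˡ {p} r (e ∘ suc)) i))
        (K.+-identityˡ _))

  *-congˡ : ∀ {p r} s → p ≈ r → p * s ≈ r * s
  *-congˡ {[]}    {r}     s e = ≈-sym {r * s} {[]} (*-zeroˡ {r} s (≈-sym {[]} {r} e))
  *-congˡ {a ∷ p} {[]}    s e = *-zeroˡ {a ∷ p} s e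
  *-congˡ {a ∷ p} {b ∷ r} s e i =
    trans (coeff-∷* a p s i)
      (trans (cong₂ _+ᶠ_ (cong (_*ᶠ _) (e 0)) (∷-cong refl (*-congˡ {p} {r} s (e ∘ suc)) i))
        (sym (coeff-∷* b r s i)))

  *-cong : ∀ {p p′ r r′} → p ≈ p′ → r ≈ r′ → p * r ≈ p′ * r′
  *-cong {p} {p′} {r} {r′} e f =
    ≈-trans {p * r} {p′ * r} {p′ * r′} (*-congˡ {p} {p′} r e) (*-congʳ p′ f)

  *-zeroʳ : ∀ p {r} → r ≈ [] → p * r ≈ []
  *-zeroʳ []      e i = refl
  *-zeroʳ (a ∷ p) {r} e i =
    trans (coeff-∷* a p r i)
      (trans (cong₂ _+ᶠ_ (trans (cong (a *ᶠ_) (e i)) (K.zeroʳ a)) (0∷≈0 (*-zeroʳ p e) i))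
        (K.+-identityˡ _))

  coeff>deg : ∀ p {i} → deg p < i → coeff p i ≡ 0ᶠ
  coeff>deg []      _ = refl
  coeff>deg (a ∷ p) {suc i} d<i with p ≈? []
  ... | yes e = e i
  ... | no  _ = coeff>deg p (ℕ.≤-pred d<i)

  coeff-deg≢0 : ∀ p → ¬ p ≈ [] → coeff p (deg p) ≢ 0ᶠ
  coeff-deg≢0 []      p≉0 _ = p≉0 λ _ → refl
  coeff-deg≢0 (a ∷ p) p≉0 e with p ≈? []
  ... | yes es = p≉0 (≈-cons {a ∷ p} {[]} e es)
  ... | no  es = coeff-deg≢0 p es e

  coeff≢0⇒≤deg : ∀ p {i} → coeff p i ≢ 0ᶠ → i ≤ deg p
  coeff≢0⇒≤deg p c = ℕ.≮⇒≥ (c ∘ coeff>deg p)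

  deg-cong : ∀ {p r} → p ≈ r → deg p ≡ deg r
  deg-cong {p} {r} e with p ≈? []
  ... | yes p≈0 = trans (deg-0 p p≈0) (sym (deg-0 r λ i → trans (sym (e i)) (p≈0 i)))
    where
    deg-0 : ∀ p → p ≈ [] → deg p ≡ 0
    deg-0 []      _ = refl
    deg-0 (a ∷ p) f with p ≈? []
    ... | yes _ = refl
    ... | no  g = contradiction (f ∘ suc) g
  ... | no p≉0 = ℕ.≤-antisym
    (coeff≢0⇒≤deg r λ c → coeff-deg≢0 p p≉0 (trans (e _) c))
    (coeff≢0⇒≤deg p λ c → coeff-deg≢0 r (λ r≈0 → p≉0 (≈-trans {p} {r} {[]} e r≈0)) (trans (sym (e _)) c))

  coeff-*-top : ∀ p r → coeff (p * r) (deg p ℕ.+ deg r) ≡ coeff p (deg p) *ᶠ coeff r (deg r)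
  coeff-*-top []      r = sym (K.zeroˡ _)
  coeff-*-top (a ∷ p) r with p ≈? []
  ... | yes e = trans (coeff-∷* a p r (deg r))
                  (trans (cong (_ +ᶠ_) (0∷≈0 (*-zeroˡ {p} r e) (deg r))) (K.+-identityʳ _))
  ... | no  _ = trans (coeff-∷* a p r (suc (deg p ℕ.+ deg r)))
                  (trans (cong₂ _+ᶠ_
                           (trans (cong (a *ᶠ_) (coeff>deg r (s≤s (ℕ.m≤n+m (deg r) (deg p)))))
                                  (K.zeroʳ a))
                           (coeff-*-top p r))
                    (K.+-identityˡ _))

  *ᶠ-nonzero : ∀ {x y} → x ≢ 0ᶠ → y ≢ 0ᶠ → x *ᶠ y ≢ 0ᶠ
  *ᶠ-nonzero {x} {y} x≢0 y≢0 xy≡0 = y≢0 (begin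
    y               ≡⟨ K.*-identityˡ y ⟨
    1ᶠ *ᶠ y         ≡⟨ cong (_*ᶠ y) (trans (K.*-comm x⁻¹ x) xx⁻¹≡1) ⟨
    (x⁻¹ *ᶠ x) *ᶠ y ≡⟨ K.*-assoc x⁻¹ x y ⟩
    x⁻¹ *ᶠ (x *ᶠ y) ≡⟨ cong (x⁻¹ *ᶠ_) xy≡0 ⟩
    x⁻¹ *ᶠ 0ᶠ       ≡⟨ K.zeroʳ x⁻¹ ⟩
    0ᶠ              ∎)
    where
    open ≡-Reasoning
    x⁻¹    = proj₁ (inverse x x≢0)
    xx⁻¹≡1 = proj₂ (inverse x x≢0)

  deg-factors : ∀ p r {f} → ¬ f ≈ [] → p * r ≈ f → deg p ℕ.+ deg r ≤ deg f
  deg-factors p r {f} f≉0 e = coeff≢0⇒≤deg f λ c →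
    *ᶠ-nonzero (coeff-deg≢0 p λ p≈0 → f≉0 (≈-trans {f} {p * r} {[]} (≈-sym {p * r} {f} e) (*-zeroˡ {p} r p≈0)))
               (coeff-deg≢0 r λ r≈0 → f≉0 (≈-trans {f} {p * r} {[]} (≈-sym {p * r} {f} e) (*-zeroʳ p r≈0)))
               (trans (sym (coeff-*-top p r)) (trans (e _) c))

  ∈-elements : ∀ x → x ∈ elements
  ∈-elements x = subst (_∈ elements) (strictlyInverseʳ x) (∈-map⁺ from (∈-allFin (to x)))
    where open Inverse enumeration

  elements-unique : Unique elements
  elements-unique = Unique.map⁺ inj (Unique.allFin⁺ q)
    where
    open Inverse enumeration
    inj : ∀ {x y} → from x ≡ from y → x ≡ y
    inj {x} {y} e = trans (sym (strictlyInverseˡ x)) (trans (cong to e) (strictlyInverseˡ y))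

  tuples-unique : ∀ n → Unique (tuples n)
  tuples-unique zero    = [] ∷ []
  tuples-unique (suc n) =
    Unique.cartesianProductWith⁺ _∷_ ∷-injective elements-unique (tuples-unique n)

  truncate : ℕ → Poly → Poly
  truncate zero    _       = []
  truncate (suc n) []      = 0ᶠ ∷ truncate n []
  truncate (suc n) (a ∷ p) = a ∷ truncate n p

  truncate∈tuples : ∀ n p → truncate n p ∈ tuples n
  truncate∈tuples zero    p       = here refl
  truncate∈tuples (suc n) []      =
    ∈-cartesianProductWith⁺ _∷_ (∈-elements 0ᶠ) (truncate∈tuples n [])
  truncate∈tuples (suc n) (a ∷ p) =
    ∈-cartesianProductWith⁺ _∷_ (∈-elements a) (truncate∈tuples n p)

  truncate-++ : ∀ n p r → (∀ i → coeff p (n ℕ.+ i) ≡ coeff r i) → truncate n p ++ r ≈ p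
  truncate-++ zero    p       r e i       = sym (e i)
  truncate-++ (suc n) []      r e zero    = refl
  truncate-++ (suc n) []      r e (suc i) = truncate-++ n [] r e i
  truncate-++ (suc n) (a ∷ p) r e zero    = refl
  truncate-++ (suc n) (a ∷ p) r e (suc i) = truncate-++ n p r e i

  truncate-≈ : ∀ n p → deg p ≤ n → truncate (suc n) p ≈ p
  truncate-≈ n p d = subst (_≈ p) (++-identityʳ (truncate (suc n) p))
    (truncate-++ (suc n) p [] λ i → coeff>deg p (s≤s (ℕ.≤-trans d (ℕ.m≤m+n n i))))

  private
    search : ∀ n {P : Poly → Set} → (∀ p → Dec (P p)) → (∀ {p r} → p ≈ r → P p → P r) →
             (∀ {p} → P p → deg p ≤ n) → Dec (∃[ p ] P p)
    search n P? resp bound with any? P? (tuples (suc n))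
    ... | yes a = yes (let p , _ , Pp = find a in p , Pp)
    ... | no ¬a = no λ (p , Pp) → ¬a (lose (truncate∈tuples (suc n) p)
                    (resp (≈-sym {truncate (suc n) p} {p} (truncate-≈ n p (bound Pp))) Pp))

  _∣?_ : ∀ p f → Dec (p ∣ f)
  p ∣? f with f ≈? []
  ... | yes f≈0 = yes ([] ∣-, ≈-sym {f} {[]} f≈0)
  ... | no  f≉0 = map′ (λ (r , e) → r ∣-, e) (λ (r ∣-, e) → r , e)
    (search (deg f) (λ r → r * p ≈? f)
      (λ {r} {s} r≈s e → ≈-trans {s * p} {r * p} {f} (*-congˡ {s} {r} p (≈-sym {r} {s} r≈s)) e)
      (λ {r} e → ℕ.≤-trans (ℕ.m≤m+n (deg r) (deg p)) (deg-factors r p {f} f≉0 e)))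

  ∣-respˡ : ∀ {p p′ f} → p ≈ p′ → p ∣ f → p′ ∣ f
  ∣-respˡ {p} {p′} {f} p≈p′ (r ∣-, e) =
    r ∣-, ≈-trans {r * p′} {r * p} {f} (*-congʳ r (≈-sym {p} {p′} p≈p′)) e

  Irreducible-resp : ∀ {p p′} → p ≈ p′ → Irreducible p → Irreducible p′
  Irreducible-resp {p} {p′} e (mkIrred p∤1 split) = mkIrred
    (p∤1 ∘ ∣-respˡ {p′} {p} (≈-sym {p} {p′} e))
    (λ {x} {y} f → split {x} {y} (≈-trans {p} {p′} {x * y} e f))

  irreducible? : ∀ p → Dec (Irreducible p)
  irreducible? p with p ≈? []
  ... | yes p≈0 = no λ (mkIrred _ split) → 0∤1 (reduce (split {[]} {[]} p≈0))
    where
    0∤1 : [] ∤ (1ᶠ ∷ [])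
    0∤1 (r ∣-, e) = 0≢1 (trans (sym (*-zeroʳ r {[]} (λ _ → refl) 0)) (e 0))
  ... | no p≉0 = map′ to from (¬? (p ∣? one) ×-dec ¬? splits?)
    where
    one = 1ᶠ ∷ []

    Splits : Poly → Poly → Set
    Splits x y = x * y ≈ p × ¬ x ∣ one × ¬ y ∣ one

    splits? : Dec (∃[ x ] ∃[ y ] Splits x y)
    splits? = search (deg p)
      (λ x → search (deg p)
        (λ y → x * y ≈? p ×-dec ¬? (x ∣? one) ×-dec ¬? (y ∣? one))
        (λ {y} {y′} y≈y′ (e , x∤1 , y∤1) →
            ≈-trans {x * y′} {x * y} {p} (*-congʳ x (≈-sym {y} {y′} y≈y′)) e
          , x∤1 , y∤1 ∘ ∣-respˡ {y′} {y} (≈-sym {y} {y′} y≈y′))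
        (λ {y} (e , _) → ℕ.≤-trans (ℕ.m≤n+m (deg y) (deg x)) (deg-factors x y {p} p≉0 e)))
      (λ {x} {x′} x≈x′ (y , e , x∤1 , y∤1) →
          y
        , ≈-trans {x′ * y} {x * y} {p} (*-congˡ {x′} {x} y (≈-sym {x} {x′} x≈x′)) e
        , x∤1 ∘ ∣-respˡ {x′} {x} (≈-sym {x} {x′} x≈x′) , y∤1)
      (λ {x} (y , e , _) → ℕ.≤-trans (ℕ.m≤m+n (deg x) (deg y)) (deg-factors x y {p} p≉0 e))

    to : ¬ p ∣ one × ¬ (∃[ x ] ∃[ y ] Splits x y) → Irreducible p
    to (p∤1 , ¬splits) = mkIrred p∤1 split
      where
      split : ∀ {x y} → p ≈ x * y → x ∣ one ⊎ y ∣ one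
      split {x} {y} e with x ∣? one | y ∣? one
      ... | yes x∣1 | _       = inj₁ x∣1
      ... | no  _   | yes y∣1 = inj₂ y∣1
      ... | no  x∤1 | no  y∤1 = contradiction (x , y , ≈-sym {p} {x * y} e , x∤1 , y∤1) ¬splits

    from : Irreducible p → ¬ p ∣ one × ¬ (∃[ x ] ∃[ y ] Splits x y)
    from (mkIrred p∤1 split) = p∤1 , λ (x , y , e , x∤1 , y∤1) →
      [ x∤1 , y∤1 ]′ (split {x} {y} (≈-sym {x * y} {p} e))

  -- Every monic divisor of a nonzero f has degree at most deg f, so searching up
  -- to deg f loses nothing (see P⁺-upper and P⁺-attained); P⁺ 1 = 0.
  monicIrreducibleDivisors : Poly → List Poly
  monicIrreducibleDivisors f =
    filter (λ p → irreducible? p ×-dec p ∣? f) (concatMap 𝓜 (upTo (suc (deg f))))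

  P⁺ : Poly → ℕ
  P⁺ f = max 0 (map deg (monicIrreducibleDivisors f))

  private
    coeff-++-1 : ∀ n {t} → t ∈ tuples n → Monic n (t ++ 1ᶠ ∷ [])
    coeff-++-1 zero    (here refl) with [] ≈? []
    ... | yes _ = refl , refl
    ... | no ¬e = contradiction (λ _ → refl) ¬e
    coeff-++-1 (suc n) t∈ with ∈-cartesianProductWith⁻ _∷_ elements (tuples n) t∈
    ... | a , u , _ , u∈ , refl with coeff-++-1 n u∈ | (u ++ 1ᶠ ∷ []) ≈? []
    ...   | d , c | yes e = contradiction (trans (sym (e n)) c) 0≢1
    ...   | d , c | no  _ = cong suc d , c

  𝓜-sound : ∀ n {f} → f ∈ 𝓜 n → Monic n f
  𝓜-sound n f∈ with ∈-map⁻ (_++ 1ᶠ ∷ []) f∈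
  ... | t , t∈ , refl = coeff-++-1 n t∈

  𝓜-complete : ∀ n f → Monic n f → ∃[ g ] g ∈ 𝓜 n × g ≈ f
  𝓜-complete n f (d , c) =
      truncate n f ++ 1ᶠ ∷ []
    , ∈-map⁺ (_++ 1ᶠ ∷ []) (truncate∈tuples n f)
    , truncate-++ n f (1ᶠ ∷ []) tail
    where
    tail : ∀ i → coeff f (n ℕ.+ i) ≡ coeff (1ᶠ ∷ []) i
    tail zero    = trans (cong (coeff f) (ℕ.+-identityʳ n)) c
    tail (suc i) = coeff>deg f (subst (_< n ℕ.+ suc i) (sym d) (ℕ.m<m+n n (s≤s z≤n)))

  𝓜-unique : ∀ n → Unique (𝓜 n)
  𝓜-unique n = Unique.map⁺ (++-cancelʳ _ _ _) (tuples-unique n)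

  𝓜-distinct : ∀ n {f g} → f ∈ 𝓜 n → g ∈ 𝓜 n → f ≈ g → f ≡ g
  𝓜-distinct n f∈ g∈ e with ∈-map⁻ (_++ 1ᶠ ∷ []) f∈ | ∈-map⁻ (_++ 1ᶠ ∷ []) g∈
  ... | t , t∈ , refl | u , u∈ , refl = lemma n t∈ u∈ e
    where
    lemma : ∀ n {t u} → t ∈ tuples n → u ∈ tuples n →
            t ++ 1ᶠ ∷ [] ≈ u ++ 1ᶠ ∷ [] → t ++ 1ᶠ ∷ [] ≡ u ++ 1ᶠ ∷ []
    lemma zero    (here refl) (here refl) _ = refl
    lemma (suc n) t∈ u∈ e
      with ∈-cartesianProductWith⁻ _∷_ elements (tuples n) t∈
         | ∈-cartesianProductWith⁻ _∷_ elements (tuples n) u∈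
    ... | a , t , _ , t∈′ , refl | b , u , _ , u∈′ , refl =
      cong₂ _∷_ (e 0) (lemma n t∈′ u∈′ (e ∘ suc))

  P⁺-upper : ∀ {n p f} → ¬ f ≈ [] → Monic n p → Irreducible p → p ∣ f → n ≤ P⁺ f
  P⁺-upper {n} {p} {f} f≉0 (d , c) irr (r ∣-, e) =
    subst (_≤ P⁺ f) (proj₁ (𝓜-sound n g∈))
      (All.lookup (xs≤max 0 (map deg (monicIrreducibleDivisors f)))
        (∈-map⁺ deg (∈-filter⁺ (λ p → irreducible? p ×-dec p ∣? f)
          (∈-concatMap⁺ 𝓜 (lose (∈-upTo⁺ (s≤s n≤)) g∈))
          (Irreducible-resp {p} {g} p≈g irr , ∣-respˡ {p} {g} {f} p≈g (r ∣-, e)))))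
    where
    rep = 𝓜-complete n p (d , c)
    g   = proj₁ rep
    g∈  = proj₁ (proj₂ rep)
    p≈g = ≈-sym {g} {p} (proj₂ (proj₂ rep))
    n≤ : n ≤ deg f
    n≤ = subst (_≤ deg f) d (ℕ.≤-trans (ℕ.m≤n+m (deg p) (deg r)) (deg-factors r p {f} f≉0 e))

  P⁺-attained : ∀ f → P⁺ f ≡ 0 ⊎ (∃[ p ] Monic (P⁺ f) p × Irreducible p × p ∣ f)
  P⁺-attained f with argmax-sel id 0 (map deg (monicIrreducibleDivisors f))
  ... | inj₁ e = inj₁ e
  ... | inj₂ m∈ with ∈-map⁻ deg m∈
  ...   | p , p∈ , e with ∈-filter⁻ (λ p → irreducible? p ×-dec p ∣? f) p∈
  ...     | p∈′ , irr , p∣f with find (∈-concatMap⁻ 𝓜 {xs = upTo (suc (deg f))} p∈′)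
  ...       | n , _ , p∈𝓜 with 𝓜-sound n p∈𝓜
  ...         | refl , c = inj₂ (p , (sym e , trans (cong (coeff p) e) c) , irr , p∣f)

{-# OPTIONS --safe #-}

-- Let p run through the monic irreducibles in order of degree and, for a list L closed
-- under passing to smaller degrees, count the F all of whose prime divisors lie in L.
-- Buchstab's identity splits such F by whether the largest prime p divides F.  For an
-- interval of length q^m this gives Ψ_{p∷L}(I) ≤ Ψ_L(I) + Ψ_{p∷L}(I/p), where I/p is
-- again (contained in) an interval, of length q^(m - deg p); for the full set of monic
-- polynomials of degree m it is an equality.  Induction on L and m compares the two,
-- as long as deg p ≤ m; if deg p > m then every monic polynomial of degree m is counted
-- and the bound q^m is trivial.
module Submission where

open import Defs
open import Algebra.Bundles using (CommutativeRing; AbelianGroup)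
import Algebra.Properties.CommutativeSemigroup as CommutativeSemigroupProperties
import Algebra.Properties.Ring as RingProperties
open import Data.List.Base using (List; []; _∷_; _++_; map; filter; length; upTo; concatMap)
open import Data.List.Extrema.Nat using (xs≤max; max≤v⁺)
open import Data.List.Membership.Propositional using (_∈_; _∉_; lose; find)
open import Data.List.Membership.Propositional.Properties
  using (∈-map⁺; ∈-map⁻; ∈-filter⁺; ∈-filter⁻; ∈-upTo⁺; ∈-upTo⁻; ∈-concatMap⁺; ∈-concatMap⁻
        ; ∈-++⁺ˡ; ∈-++⁺ʳ; ∈-++⁻; ∈-∃++)
import Data.List.Membership.DecPropositional as DecMembership
open import Data.List.Properties using (length-map; length-++; ≡-dec; filter-≐)
open import Data.List.Relation.Binary.Subset.Propositional using (_⊆_)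
open import Data.List.Relation.Unary.All as All using (All; []; _∷_)
import Data.List.Relation.Unary.All.Properties as All
open import Data.List.Relation.Unary.AllPairs as AllPairs using (AllPairs; []; _∷_)
import Data.List.Relation.Unary.AllPairs.Properties as AllPairs
open import Data.List.Relation.Unary.Any using (any?; here; there)
open import Data.List.Relation.Unary.Unique.Propositional using (Unique)
import Data.List.Relation.Unary.Unique.Propositional.Properties as Unique
open import Data.Nat.Base as ℕ using (ℕ; zero; suc; _≤_; _<_; _∸_; z≤n; s≤s; z<s)
import Data.Nat.Properties as ℕ
open import Data.Nat.Induction using (Acc; acc; <-wellFounded)
open import Data.Product.Base using (∃-syntax; _×_; _,_; proj₁; proj₂)
open import Data.Sum.Base using (_⊎_; inj₁; inj₂)
open import Function.Base using (_∘_; case_of_)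
open import Level using (Level; 0ℓ)
open import Relation.Binary.PropositionalEquality as ≡
  using (_≡_; _≢_; cong; cong₂; subst; module ≡-Reasoning)
open import Relation.Binary.Structures using (IsEquivalence)
open import Relation.Nullary using (¬_; Dec; yes; no; contradiction)
open import Relation.Nullary.Decidable using (_×-dec_; ¬?)
open import Relation.Unary using (Pred; Decidable)

-- Counting in lists.

module _ {a : Level} {A : Set a} where
  open ≡ using (refl; sym; trans)

  -- Delete from `ys` the occurrence of the head `x`; by uniqueness the tail of `xs` still lies in
  -- what remains.
  unique-⊆⇒length≤ : {xs ys : List A} → Unique xs → xs ⊆ ys → length xs ≤ length ys
  unique-⊆⇒length≤ [] _ = z≤n
  unique-⊆⇒length≤ {x ∷ xs} (x∉xs ∷ xs!) x∷xs⊆ys with ∈-∃++ (x∷xs⊆ys (here refl))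
  ... | us , vs , refl = begin
    suc (length xs)                 ≤⟨ s≤s (unique-⊆⇒length≤ xs! xs⊆us++vs) ⟩
    suc (length (us ++ vs))         ≡⟨ cong suc (length-++ us) ⟩
    suc (length us ℕ.+ length vs)   ≡⟨ ℕ.+-suc (length us) (length vs) ⟨
    length us ℕ.+ length (x ∷ vs)   ≡⟨ length-++ us ⟨
    length (us ++ x ∷ vs)           ∎
    where
    open ℕ.≤-Reasoning
    xs⊆us++vs : xs ⊆ us ++ vs
    xs⊆us++vs z∈xs with ∈-++⁻ us (x∷xs⊆ys (there z∈xs))
    ... | inj₁ z∈us         = ∈-++⁺ˡ z∈us
    ... | inj₂ (here refl)  = contradiction refl (All.lookup x∉xs z∈xs)
    ... | inj₂ (there z∈vs) = ∈-++⁺ʳ us z∈vs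

  length-filter-split : ∀ {p} {P : Pred A p} (P? : Decidable P) xs →
    length xs ≡ length (filter P? xs) ℕ.+ length (filter (¬? ∘ P?) xs)
  length-filter-split P? []       = refl
  length-filter-split P? (x ∷ xs) with P? x
  ... | yes _ = cong suc (length-filter-split P? xs)
  ... | no  _ = trans (cong suc (length-filter-split P? xs)) (sym (ℕ.+-suc _ _))

  -- Serves maps that are injective, or respect differences, only on members with a known property,
  -- such as the multiples of `p`.
  AllPairs-map-All : ∀ {p r s} {P : Pred A p} {R : A → A → Set r} {S : A → A → Set s} →
    (∀ {x y} → P x → P y → R x y → S x y) →
    ∀ {xs} → All P xs → AllPairs R xs → AllPairs S xs
  AllPairs-map-All f []         []         = []
  AllPairs-map-All f (px ∷ pxs) (rx ∷ rxs) =
    All.zipWith (λ (py , r) → f px py r) (pxs , rx) ∷ AllPairs-map-All f pxs rxs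

-- Identities in commutative rings.

module RingIdentities {c ℓ} (R : CommutativeRing c ℓ) where
  open CommutativeRing R
  open RingProperties ring using (x[y-z]≈xy-xz; [y-z]x≈yx-zx; -‿+-comm)
  open import Relation.Binary.Reasoning.Setoid setoid

  x-[y+z]≈x-z-y : ∀ x y z → x - (y + z) ≈ x - z - y
  x-[y+z]≈x-z-y x y z = begin
    x - (y + z)         ≈⟨ +-congˡ (-‿cong (+-comm y z)) ⟩
    x - (z + y)         ≈⟨ +-congˡ (-‿+-comm z y) ⟨
    x + (- z - y)       ≈⟨ +-assoc x (- z) (- y) ⟨
    x - z - y           ∎

  [x-s*y]*b≈x*b-s*[y*b] : ∀ x y s b → (x - s * y) * b ≈ x * b - s * (y * b)
  [x-s*y]*b≈x*b-s*[y*b] x y s b =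
    trans ([y-z]x≈yx-zx b x (s * y)) (+-congˡ (-‿cong (*-assoc s y b)))

  -- One step of Euclid's algorithm: passing from `x` and `y` to the remainder `x - s * y` keeps `p`
  -- a divisor of the product with `b`, with an explicit cofactor.
  divides-combination : ∀ {p b x y u v} s → u * p ≈ x * b → v * p ≈ y * b →
                        (u - s * v) * p ≈ (x - s * y) * b
  divides-combination {p} {b} {x} {y} {u} {v} s e f = begin
    (u - s * v) * p       ≈⟨ [x-s*y]*b≈x*b-s*[y*b] u v s p ⟩
    u * p - s * (v * p)   ≈⟨ +-cong e (-‿cong (*-congˡ f)) ⟩
    x * b - s * (y * b)   ≈⟨ [x-s*y]*b≈x*b-s*[y*b] x y s b ⟨
    (x - s * y) * b       ∎

-- Polynomials as a commutative ring.

module PolynomialRing {q : ℕ} (𝔽 : FiniteField q) where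
  open FiniteField 𝔽 using (0ᶠ; 1ᶠ; -ᶠ_; _+ᶠ_; _*ᶠ_; commutativeRing) renaming (Carrier to K)
  open Polynomials 𝔽
  open ≡ using (refl; sym; trans)
  private
    module K = CommutativeRing commutativeRing
    module KP = RingProperties K.ring

  -- _≈_ unfolds to a Π-type from which the two polynomials cannot be inferred.
  infix 4 _≋_
  record _≋_ (p r : Poly) : Set where
    constructor pointwise
    field at : p ≈ r
  open _≋_ public

  ≋-isEquivalence : IsEquivalence _≋_
  ≋-isEquivalence = record
    { refl  = pointwise λ _ → refl
    ; sym   = λ e → pointwise λ i → sym (at e i)
    ; trans = λ e f → pointwise λ i → trans (at e i) (at f i)
    }

  private module ≋ = IsEquivalence ≋-isEquivalence

  coeff-neg : ∀ p i → coeff (- p) i ≡ -ᶠ coeff p i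
  coeff-neg []      i       = sym KP.-0#≈0#
  coeff-neg (a ∷ p) zero    = refl
  coeff-neg (a ∷ p) (suc i) = coeff-neg p i

  coeff-sub : ∀ p r i → coeff (p - r) i ≡ coeff p i +ᶠ (-ᶠ coeff r i)
  coeff-sub p r i = trans (coeff-+ p (- r) i) (cong (_ +ᶠ_) (coeff-neg r i))

  private
    +-cong : ∀ {p p′ r r′} → p ≋ p′ → r ≋ r′ → p + r ≋ p′ + r′
    +-cong {p} {p′} {r} {r′} e f = pointwise λ i →
      trans (coeff-+ p r i) (trans (cong₂ _+ᶠ_ (at e i) (at f i)) (sym (coeff-+ p′ r′ i)))

    +-assoc : ∀ p r s → p + r + s ≋ p + (r + s)
    +-assoc p r s = pointwise λ i → begin
      coeff (p + r + s) i                   ≡⟨ coeff-+ (p + r) s i ⟩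
      coeff (p + r) i +ᶠ coeff s i          ≡⟨ cong (_+ᶠ _) (coeff-+ p r i) ⟩
      coeff p i +ᶠ coeff r i +ᶠ coeff s i   ≡⟨ K.+-assoc _ _ _ ⟩
      coeff p i +ᶠ (coeff r i +ᶠ coeff s i) ≡⟨ cong (_ +ᶠ_) (coeff-+ r s i) ⟨
      coeff p i +ᶠ coeff (r + s) i          ≡⟨ coeff-+ p (r + s) i ⟨
      coeff (p + (r + s)) i                 ∎
      where open ≡-Reasoning

    +-comm : ∀ p r → p + r ≋ r + p
    +-comm p r = pointwise λ i →
      trans (coeff-+ p r i) (trans (K.+-comm _ _) (sym (coeff-+ r p i)))

    +-identityʳ : ∀ p → p + [] ≋ p
    +-identityʳ p = pointwise λ i → trans (coeff-+ p [] i) (K.+-identityʳ _)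

    -‿cong : ∀ {p r} → p ≋ r → - p ≋ - r
    -‿cong {p} {r} e = pointwise λ i →
      trans (coeff-neg p i) (trans (cong -ᶠ_ (at e i)) (sym (coeff-neg r i)))

    -‿inverseʳ : ∀ p → p - p ≋ []
    -‿inverseʳ p = pointwise λ i → trans (coeff-sub p p i) (K.-‿inverseʳ _)

  +-abelianGroup : AbelianGroup 0ℓ 0ℓ
  +-abelianGroup = record
    { Carrier = Poly ; _≈_ = _≋_ ; _∙_ = _+_ ; ε = [] ; _⁻¹ = -_
    ; isAbelianGroup = record
      { isGroup = record
        { isMonoid = record
          { isSemigroup = record
            { isMagma = record { isEquivalence = ≋-isEquivalence ; ∙-cong = +-cong }
            ; assoc   = +-assoc
            }
          ; identity = (λ _ → ≋.refl) , +-identityʳ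
          }
        ; inverse = (λ p → ≋.trans (+-comm (- p) p) (-‿inverseʳ p)) , -‿inverseʳ
        ; ⁻¹-cong = -‿cong
        }
      ; comm = +-comm
      }
    }

  private
    module + = AbelianGroup +-abelianGroup
    open CommutativeSemigroupProperties +.commutativeSemigroup
      using () renaming (interchange to +-interchange; x∙yz≈y∙xz to +-swap)
    import Relation.Binary.Reasoning.Setoid +.setoid as ≋-Reasoning

  ∷-cong′ : ∀ {a b p r} → a ≡ b → p ≋ r → a ∷ p ≋ b ∷ r
  ∷-cong′ e f = pointwise (∷-cong e (at f))

  private
    0∷-+ : ∀ p r → 0ᶠ ∷ p + r ≋ (0ᶠ ∷ p) + (0ᶠ ∷ r)
    0∷-+ p r = ∷-cong′ (sym (K.+-identityˡ 0ᶠ)) ≋.refl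

    0∷[] : 0ᶠ ∷ [] ≋ []
    0∷[] = pointwise λ { zero → refl ; (suc i) → refl }

    ·-+ˡ : ∀ a b p → (a +ᶠ b) · p ≋ a · p + b · p
    ·-+ˡ a b []      = ≋.refl
    ·-+ˡ a b (c ∷ p) = ∷-cong′ (K.distribʳ c a b) (·-+ˡ a b p)

    ·-+ʳ : ∀ a p r → a · (p + r) ≋ a · p + a · r
    ·-+ʳ a p r = pointwise λ i → begin
      coeff (a · (p + r)) i                       ≡⟨ coeff-· a (p + r) i ⟩
      a *ᶠ coeff (p + r) i                        ≡⟨ cong (a *ᶠ_) (coeff-+ p r i) ⟩
      a *ᶠ (coeff p i +ᶠ coeff r i)               ≡⟨ K.distribˡ _ _ _ ⟩
      a *ᶠ coeff p i +ᶠ a *ᶠ coeff r i            ≡⟨ cong₂ _+ᶠ_ (coeff-· a p i) (coeff-· a r i) ⟨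
      coeff (a · p) i +ᶠ coeff (a · r) i          ≡⟨ coeff-+ (a · p) (a · r) i ⟨
      coeff (a · p + a · r) i                     ∎
      where open ≡-Reasoning

    ·-assoc : ∀ a b p → (a *ᶠ b) · p ≋ a · (b · p)
    ·-assoc a b []      = ≋.refl
    ·-assoc a b (c ∷ p) = ∷-cong′ (K.*-assoc a b c) (·-assoc a b p)

    0·≋0 : ∀ p → 0ᶠ · p ≋ []
    0·≋0 p = pointwise λ i → trans (coeff-· 0ᶠ p i) (K.zeroˡ _)

    1·≋id : ∀ p → 1ᶠ · p ≋ p
    1·≋id p = pointwise λ i → trans (coeff-· 1ᶠ p i) (K.*-identityˡ _)

  0∷-* : ∀ p r → (0ᶠ ∷ p) * r ≋ 0ᶠ ∷ p * r
  0∷-* p r = +-cong (0·≋0 r) ≋.refl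

  -- The defining recursion of `_*_` carried over to the right factor; commutativity follows from it
  -- by induction on that factor.
  *-0∷ : ∀ p b r → p * (b ∷ r) ≋ b · p + (0ᶠ ∷ p * r)
  *-0∷ []      b r = ≋.sym 0∷[]
  *-0∷ (a ∷ p) b r = ∷-cong′ (cong (_+ᶠ 0ᶠ) (K.*-comm a b)) (begin
    a · r + p * (b ∷ r)            ≈⟨ +-cong {a · r} ≋.refl (*-0∷ p b r) ⟩
    a · r + (b · p + (0ᶠ ∷ p * r)) ≈⟨ +-swap (a · r) (b · p) _ ⟩
    b · p + (a · r + (0ᶠ ∷ p * r)) ∎)
    where open ≋-Reasoning

  const-* : ∀ a p → (a ∷ []) * p ≋ a · p
  const-* a p = ≋.trans (+-cong {a · p} ≋.refl 0∷[]) (+-identityʳ (a · p))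

  private
    *-distribʳ : ∀ s p r → (p + r) * s ≋ p * s + r * s
    *-distribʳ s []      r       = ≋.refl
    *-distribʳ s (a ∷ p) []      = ≋.sym (+-identityʳ _)
    *-distribʳ s (a ∷ p) (b ∷ r) = begin
      (a +ᶠ b) · s + (0ᶠ ∷ (p + r) * s)
        ≈⟨ +-cong (·-+ˡ a b s) (≋.trans (∷-cong′ refl (*-distribʳ s p r)) (0∷-+ (p * s) (r * s))) ⟩
      (a · s + b · s) + ((0ᶠ ∷ p * s) + (0ᶠ ∷ r * s))
        ≈⟨ +-interchange (a · s) (b · s) _ _ ⟩
      (a · s + (0ᶠ ∷ p * s)) + (b · s + (0ᶠ ∷ r * s)) ∎
      where open ≋-Reasoning

    ·-*-assoc : ∀ a p r → (a · p) * r ≋ a · (p * r)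
    ·-*-assoc a []      r = ≋.refl
    ·-*-assoc a (b ∷ p) r = begin
      (a *ᶠ b) · r + (0ᶠ ∷ (a · p) * r)
        ≈⟨ +-cong (·-assoc a b r) (∷-cong′ (sym (K.zeroʳ a)) (·-*-assoc a p r)) ⟩
      a · (b · r) + a · (0ᶠ ∷ p * r) ≈⟨ ·-+ʳ a (b · r) _ ⟨
      a · (b · r + (0ᶠ ∷ p * r))     ∎
      where open ≋-Reasoning

    *-assoc : ∀ p r s → p * r * s ≋ p * (r * s)
    *-assoc []      r s = ≋.refl
    *-assoc (a ∷ p) r s = begin
      (a · r + (0ᶠ ∷ p * r)) * s         ≈⟨ *-distribʳ s (a · r) _ ⟩
      (a · r) * s + (0ᶠ ∷ p * r) * s     ≈⟨ +-cong (·-*-assoc a r s) (0∷-* (p * r) s) ⟩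
      a · (r * s) + (0ᶠ ∷ p * r * s)     ≈⟨ +-cong {a · (r * s)} ≋.refl (∷-cong′ refl (*-assoc p r s)) ⟩
      a · (r * s) + (0ᶠ ∷ p * (r * s))   ∎
      where open ≋-Reasoning

    *-comm : ∀ p r → p * r ≋ r * p
    *-comm p []      = pointwise (*-zeroʳ p {[]} λ _ → refl)
    *-comm p (b ∷ r) =
      ≋.trans (*-0∷ p b r) (+-cong {b · p} ≋.refl (∷-cong′ refl (*-comm p r)))

    *-identityˡ : ∀ p → (1ᶠ ∷ []) * p ≋ p
    *-identityˡ p = ≋.trans (const-* 1ᶠ p) (1·≋id p)

  polynomialRing : CommutativeRing 0ℓ 0ℓ
  polynomialRing = record
    { Carrier = Poly ; _≈_ = _≋_ ; _+_ = _+_ ; _*_ = _*_ ; -_ = -_ ; 0# = [] ; 1# = 1ᶠ ∷ []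
    ; isCommutativeRing = record
      { isRing = record
        { +-isAbelianGroup = +.isAbelianGroup
        ; *-cong     = λ {p} {p′} {r} {r′} e f → pointwise (*-cong {p} {p′} {r} {r′} (at e) (at f))
        ; *-assoc    = *-assoc
        ; *-identity = *-identityˡ , λ p → ≋.trans (*-comm p _) (*-identityˡ p)
        ; distrib    = (λ s p r → ≋.trans (*-comm s (p + r)) (≋.trans (*-distribʳ s p r)
                          (+-cong (*-comm p s) (*-comm r s)))) , *-distribʳ
        }
      ; *-comm = *-comm
      }
    }

-- Degrees, division with remainder and Euclid's lemma.

module PolynomialArithmetic {q : ℕ} (𝔽 : FiniteField q) where
  open FiniteField 𝔽 using (0ᶠ; 1ᶠ; -ᶠ_; _+ᶠ_; _*ᶠ_; 0≢1; inverse; commutativeRing) renaming (Carrier to K)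
  open Polynomials 𝔽
  open PolynomialRing 𝔽
  open RingIdentities polynomialRing
  open ≡ using (refl; sym; trans)
  private
    module K = CommutativeRing commutativeRing
    module R = CommutativeRing polynomialRing
    module RP = RingProperties R.ring
    import Relation.Binary.Reasoning.Setoid R.setoid as ≋-Reasoning

  -- Used instead of `deg p < n`: since `deg [] = 0`, that inequality fails for the zero polynomial
  -- at `n = 0`, whereas `Low 0` singles out zero.
  Low : ℕ → Poly → Set
  Low n p = ∀ i → n ≤ i → coeff p i ≡ 0ᶠ

  Low-resp : ∀ {n p r} → p ≋ r → Low n p → Low n r
  Low-resp e low i n≤i = trans (sym (at e i)) (low i n≤i)

  Low⇒deg< : ∀ {n p} → ¬ p ≈ [] → Low n p → deg p < n
  Low⇒deg< {p = p} p≉0 low = ℕ.≰⇒> λ n≤ → coeff-deg≢0 p p≉0 (low (deg p) n≤)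

  deg<⇒Low : ∀ {n} p → deg p < n → Low n p
  deg<⇒Low p d i n≤i = coeff>deg p (ℕ.<-≤-trans d n≤i)

  one : Poly
  one = 1ᶠ ∷ []

  Monic-one : Monic 0 one
  Monic-one with [] ≈? []
  ... | yes _ = refl , refl
  ... | no e  = contradiction (λ _ → refl) e

  Monic⇒≉0 : ∀ {n p} → Monic n p → ¬ p ≈ []
  Monic⇒≉0 {n} (_ , c) e = 0≢1 (trans (sym (e n)) c)

  Monic-resp : ∀ {n p r} → p ≋ r → Monic n p → Monic n r
  Monic-resp {n} {p} {r} e (d , c) =
    trans (sym (deg-cong {p} {r} (at e))) d , trans (sym (at e n)) c

  Monic-0⇒≋one : ∀ {p} → Monic 0 p → p ≋ one
  Monic-0⇒≋one {p} (d , c) = pointwise λ where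
    zero    → c
    (suc i) → coeff>deg p (subst (_< suc i) (sym d) z<s)

  *-nonzero : ∀ p r → ¬ p ≈ [] → ¬ r ≈ [] → ¬ p * r ≈ []
  *-nonzero p r p≉0 r≉0 e = *ᶠ-nonzero (coeff-deg≢0 p p≉0) (coeff-deg≢0 r r≉0)
    (trans (sym (coeff-*-top p r)) (e _))

  coeff-*-above : ∀ p r {i} → deg p ℕ.+ deg r < i → coeff (p * r) i ≡ 0ᶠ
  coeff-*-above []      r lt = refl
  coeff-*-above (a ∷ p) r {suc i} lt with p ≈? []
  ... | yes e = begin
    coeff ((a ∷ p) * r) (suc i)                ≡⟨ coeff-∷* a p r (suc i) ⟩
    a *ᶠ coeff r (suc i) +ᶠ coeff (p * r) i    ≡⟨ cong₂ _+ᶠ_ (cong (a *ᶠ_) (coeff>deg r lt)) (*-zeroˡ {p} r e i) ⟩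
    a *ᶠ 0ᶠ +ᶠ 0ᶠ                              ≡⟨ trans (K.+-identityʳ _) (K.zeroʳ a) ⟩
    0ᶠ                                         ∎
    where open ≡-Reasoning
  ... | no  _ = begin
    coeff ((a ∷ p) * r) (suc i)                ≡⟨ coeff-∷* a p r (suc i) ⟩
    a *ᶠ coeff r (suc i) +ᶠ coeff (p * r) i
      ≡⟨ cong₂ _+ᶠ_ (cong (a *ᶠ_) (coeff>deg r (ℕ.≤-<-trans (ℕ.m≤n+m (deg r) (suc (deg p))) lt)))
                    (coeff-*-above p r (ℕ.≤-pred lt)) ⟩
    a *ᶠ 0ᶠ +ᶠ 0ᶠ                              ≡⟨ trans (K.+-identityʳ _) (K.zeroʳ a) ⟩
    0ᶠ                                         ∎
    where open ≡-Reasoning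

  deg-* : ∀ p r → ¬ p ≈ [] → ¬ r ≈ [] → deg (p * r) ≡ deg p ℕ.+ deg r
  deg-* p r p≉0 r≉0 = ℕ.≤-antisym
    (ℕ.≮⇒≥ (coeff-deg≢0 (p * r) (*-nonzero p r p≉0 r≉0) ∘ coeff-*-above p r))
    (deg-factors p r {p * r} (*-nonzero p r p≉0 r≉0) λ _ → refl)

  Monic-* : ∀ {m n p r} → Monic m p → Monic n r → Monic (m ℕ.+ n) (p * r)
  Monic-* {p = p} {r} P@(refl , c) R@(refl , d) =
    deg-* p r (Monic⇒≉0 {p = p} P) (Monic⇒≉0 {p = r} R) ,
    trans (coeff-*-top p r) (trans (cong₂ _*ᶠ_ c d) (K.*-identityˡ 1ᶠ))

  Monic-quotient : ∀ {m n p r} → Monic (n ℕ.+ m) (p * r) → Monic m r → Monic n p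
  Monic-quotient {m} {n} {p} {r} P@(d , c) R@(refl , c′) = deg-p , (begin
    coeff p n                           ≡⟨ cong (coeff p) deg-p ⟨
    coeff p (deg p)                     ≡⟨ K.*-identityʳ _ ⟨
    coeff p (deg p) *ᶠ 1ᶠ               ≡⟨ cong (_ *ᶠ_) c′ ⟨
    coeff p (deg p) *ᶠ coeff r (deg r)  ≡⟨ coeff-*-top p r ⟨
    coeff (p * r) (deg p ℕ.+ deg r)     ≡⟨ cong (λ k → coeff (p * r) (k ℕ.+ deg r)) deg-p ⟩
    coeff (p * r) (n ℕ.+ deg r)         ≡⟨ c ⟩
    1ᶠ                                  ∎)
    where
    open ≡-Reasoning
    p≉0 : ¬ p ≈ []
    p≉0 e = Monic⇒≉0 {p = p * r} P (*-zeroˡ {p} r e)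
    deg-p : deg p ≡ n
    deg-p = ℕ.+-cancelʳ-≡ (deg r) (deg p) n
      (trans (sym (deg-* p r p≉0 (Monic⇒≉0 {p = r} R))) d)

  -- Degrees add in a product of nonzero factors. This shortens an interval on division by `p`, and
  -- for `n = 0` it yields cancellation of monic factors.
  Low-quotient : ∀ {m p} r n → Monic m p → Low (m ℕ.+ n) (p * r) → Low n r
  Low-quotient {p = p} r n P@(refl , _) low with r ≈? []
  ... | yes r≈0 = λ i _ → r≈0 i
  ... | no  r≉0 = deg<⇒Low r (ℕ.+-cancelˡ-< (deg p) (deg r) n
    (subst (_< deg p ℕ.+ n) (deg-* p r p≉0 r≉0)
      (Low⇒deg< {p = p * r} (*-nonzero p r p≉0 r≉0) low)))
    where p≉0 = Monic⇒≉0 {p = p} P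

  *-cancelˡ-≋ : ∀ {m p r s} → Monic m p → p * r ≋ p * s → r ≋ s
  *-cancelˡ-≋ {m} {p} {r} {s} P e = RP.x∙y⁻¹≈ε⇒x≈y r s (pointwise λ i →
    Low-quotient {p = p} (r - s) 0 P
      (λ j _ → at (R.trans (RP.x[y-z]≈xy-xz p r s) (R.trans (R.+-congʳ e) (R.-‿inverseʳ (p * s)))) j) i z≤n)

  divMod : ∀ a → ¬ a ≈ [] → ∀ f → ∃[ s ] Low (deg a) (f - s * a)
  divMod a a≉0 []      = [] , λ i _ → refl
  divMod a a≉0 (c ∷ f) with divMod a a≉0 f
  -- Long division from the top coefficient down: as `f - s * a` is below degree `n`, the shifted
  -- remainder `u` vanishes above `n`, and `k` is chosen so that `k · a` cancels its coefficient at
  -- `n`.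
  ... | s , low = k ∷ s , Low-resp (R.sym step) reduced
    where
    n = deg a
    lead⁻¹ = inverse (coeff a n) (coeff-deg≢0 a a≉0)
    u = c ∷ (f - s * a)
    k = coeff u n *ᶠ proj₁ lead⁻¹

    step : (c ∷ f) - (k ∷ s) * a ≋ u - k · a
    step = R.trans (x-[y+z]≈x-z-y (c ∷ f) (k · a) (0ᶠ ∷ s * a))
      (R.+-congʳ {x = - (k · a)} (∷-cong′ (trans (cong (c +ᶠ_) -0≡0) (K.+-identityʳ c)) R.refl))
      where -0≡0 = RingProperties.-0#≈0# K.ring

    cancel-lead : coeff u n ≡ k *ᶠ coeff a n
    cancel-lead = sym (trans (K.*-assoc _ _ _) (trans
      (cong (coeff u n *ᶠ_) (trans (K.*-comm _ _) (proj₂ lead⁻¹))) (K.*-identityʳ _)))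

    above : ∀ i → n < i → coeff u i ≡ k *ᶠ coeff a i
    above (suc i) n<i = trans (low i (ℕ.≤-pred n<i))
      (sym (trans (cong (k *ᶠ_) (coeff>deg a n<i)) (K.zeroʳ k)))

    agree : ∀ i → n ≤ i → coeff u i ≡ k *ᶠ coeff a i
    agree i n≤i with ℕ.m≤n⇒m<n∨m≡n n≤i
    ... | inj₁ n<i  = above i n<i
    ... | inj₂ refl = cancel-lead

    reduced : Low n (u - k · a)
    reduced i n≤i = trans (coeff-sub u (k · a) i) (trans
      (cong₂ (λ x y → x +ᶠ (-ᶠ y)) (agree i n≤i) (coeff-· k a i)) (K.-‿inverseʳ _))

  ∣1⇒deg≡0 : ∀ {p} → p ∣ one → deg p ≡ 0
  ∣1⇒deg≡0 {p} (r ∣-, e) = ℕ.n≤0⇒n≡0 (begin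
    deg p             ≤⟨ ℕ.m≤n+m (deg p) (deg r) ⟩
    deg r ℕ.+ deg p   ≤⟨ deg-factors r p {one} (Monic⇒≉0 {p = one} Monic-one) e ⟩
    deg one           ≡⟨ proj₁ Monic-one ⟩
    0                 ∎)
    where open ℕ.≤-Reasoning

  ∣⇒deg≤ : ∀ {p f} → ¬ f ≈ [] → p ∣ f → deg p ≤ deg f
  ∣⇒deg≤ {p} {f} f≉0 (r ∣-, e) = ℕ.≤-trans (ℕ.m≤n+m (deg p) (deg r)) (deg-factors r p {f} f≉0 e)

  ∣-unit : ∀ u s p {f} → u * s ≋ one → f ≋ s * p → u * f ≋ p
  ∣-unit u s p {f} us≋1 f≋sp = begin
    u * f       ≈⟨ R.*-congˡ {u} f≋sp ⟩
    u * (s * p) ≈⟨ R.*-assoc u s p ⟨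
    u * s * p   ≈⟨ R.*-congʳ {p} us≋1 ⟩
    one * p     ≈⟨ R.*-identityˡ p ⟩
    p           ∎
    where open ≋-Reasoning

  -- Instead of a Bézout identity: replacing a by the remainder of p modulo a
  -- lowers its degree and preserves p ∣ a * b.
  euclid-small : ∀ {p} → Irreducible p → ∀ a b → Acc _<_ (deg a) → ¬ a ≈ [] → deg a < deg p →
                 p ∣ a * b → p ∣ b
  euclid-small {p} irr a b (acc rs) a≉0 a<p (c ∣-, cp≈ab) with divMod a a≉0 p
  ... | s , low with (p - s * a) ≈? []
  ...   | no r≉0 = euclid-small irr r b (rs r<a) r≉0 (ℕ.<-trans r<a a<p)
            (b - s * c ∣-, at (divides-combination {p} {b} {p} {a} {b} {c} s
              (R.*-comm b p) (pointwise cp≈ab)))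
    where
    r = p - s * a
    r<a = Low⇒deg< {p = r} r≉0 low
  -- Now `p` equals `s * a`. A unit `s` would make `p` divide `a`, against the degrees; a unit `a`
  -- can be cancelled from `a * b`.
  ...   | yes r≈0 with Irreducible.split-∣1 irr {s} {a} (at (RP.x∙y⁻¹≈ε⇒x≈y p (s * a) (pointwise r≈0)))
  ...     | inj₁ (u ∣-, us≈1) = contradiction
              (∣⇒deg≤ {p} {a} a≉0 (u ∣-, at (∣-unit u s a (pointwise us≈1)
                (RP.x∙y⁻¹≈ε⇒x≈y p (s * a) (pointwise r≈0)))))
              (ℕ.<⇒≱ a<p)
  ...     | inj₂ (u ∣-, ua≈1) = u * c ∣-, at (begin
              u * c * p     ≈⟨ R.*-assoc u c p ⟩
              u * (c * p)   ≈⟨ ∣-unit u a b (pointwise ua≈1) (pointwise cp≈ab) ⟩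
              b             ∎)
    where open ≋-Reasoning

  -- Reducing `a` modulo `p` either gives zero, so that `p` divides `a`, or brings the degree below
  -- `deg p`, where `euclid-small` applies.
  euclid : ∀ {p} → Irreducible p → ¬ p ≈ [] → ∀ a b → p ∣ a * b → p ∣ a ⊎ p ∣ b
  euclid {p} irr p≉0 a b (c ∣-, cp≈ab) with divMod p p≉0 a
  ... | s , low with (a - s * p) ≈? []
  ...   | yes r≈0 = inj₁ (s ∣-, at (R.sym (RP.x∙y⁻¹≈ε⇒x≈y a (s * p) (pointwise r≈0))))
  ...   | no  r≉0 = inj₂ (euclid-small irr r b (<-wellFounded (deg r)) r≉0 (Low⇒deg< {p = r} r≉0 low)
            (c - s * b ∣-, at (divides-combination {p} {b} {a} {p} {c} {b} s
              (pointwise cp≈ab) (R.*-comm b p))))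
    where r = a - s * p

  -- The cofactor is a unit because `p` is not, and as a quotient of monic polynomials it is monic,
  -- hence 1.
  irreducible-monic-divisor : ∀ {m n p r} → Irreducible p → Monic m p → Irreducible r → Monic n r →
                              p ∣ r → p ≋ r
  irreducible-monic-divisor {m} {n} {p} {r} irr-p P irr-r M (s ∣-, sp≈r)
    with Irreducible.split-∣1 irr-r {s} {p} (λ i → sym (sp≈r i))
  ... | inj₂ p∣1 = contradiction p∣1 (Irreducible.p∤1 irr-p)
  ... | inj₁ s∣1 = begin
    p         ≈⟨ R.*-identityˡ p ⟨
    one * p   ≈⟨ R.*-congʳ {p} (Monic-0⇒≋one {s} s-monic) ⟨
    s * p     ≈⟨ pointwise sp≈r ⟩
    r         ∎
    where
    open ≋-Reasoning
    s≉0 : ¬ s ≈ []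
    s≉0 e = Monic⇒≉0 {p = r} M (λ i → trans (sym (sp≈r i)) (*-zeroˡ {s} p e i))
    n≡m : n ≡ m
    n≡m = trans (sym (proj₁ (Monic-resp {n} {r} {s * p} (R.sym (pointwise sp≈r)) M)))
      (trans (deg-* s p s≉0 (Monic⇒≉0 {p = p} P))
        (cong₂ ℕ._+_ (∣1⇒deg≡0 {s} s∣1) (proj₁ P)))
    s-monic : Monic 0 s
    s-monic = Monic-quotient {m} {0} {s} {p}
      (Monic-resp {m} {r} {s * p} (R.sym (pointwise sp≈r)) (subst (λ k → Monic k r) n≡m M)) P

-- Prime divisors of monic polynomials.

module Smoothness {q : ℕ} (𝔽 : FiniteField q) where
  open FiniteField 𝔽 using (0ᶠ; 1ᶠ; _+ᶠ_; _*ᶠ_; 0≢1; inverse; commutativeRing)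
  open Polynomials 𝔽
  open PolynomialRing 𝔽
  open PolynomialArithmetic 𝔽
  open ≡ using (refl; sym; trans)
  private
    module K = CommutativeRing commutativeRing
    module R = CommutativeRing polynomialRing
    module RP = RingProperties R.ring
    import Relation.Binary.Reasoning.Setoid R.setoid as ≋-Reasoning

  -- The constant `l` undoes the scaling, so that a factorization through `x` can be rewritten
  -- through its monic associate.
  monic-associate : ∀ x → ¬ x ≈ [] →
    ∃[ k ] ∃[ l ] (l ∷ []) * (k ∷ []) ≋ one × Monic (deg x) ((k ∷ []) * x)
  monic-associate x x≉0 =
    k , l , ∷-cong′ (trans (K.+-identityʳ _) lk≡1) R.refl ,
    Monic-resp (R.sym (const-* k x)) (ℕ.≤-antisym upper lower , lead)
    where
    l = coeff x (deg x)
    k = proj₁ (inverse l (coeff-deg≢0 x x≉0))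
    lk≡1 = proj₂ (inverse l (coeff-deg≢0 x x≉0))
    lead : coeff (k · x) (deg x) ≡ 1ᶠ
    lead = trans (coeff-· k x (deg x)) (trans (K.*-comm k l) lk≡1)
    lower : deg x ≤ deg (k · x)
    lower = coeff≢0⇒≤deg (k · x) λ c → 0≢1 (trans (sym c) lead)
    upper : deg (k · x) ≤ deg x
    upper = ℕ.≮⇒≥ λ lt → coeff-deg≢0 (k · x) (λ e → 0≢1 (trans (sym (e _)) lead))
      (trans (coeff-· k x _) (trans (cong (k *ᶠ_) (coeff>deg x lt)) (K.zeroʳ k)))

  deg≡0⇒∣1 : ∀ x → ¬ x ≈ [] → deg x ≡ 0 → x ∣ one
  deg≡0⇒∣1 x x≉0 d with monic-associate x x≉0
  ... | k , _ , _ , M =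
    (k ∷ []) ∣-, at (Monic-0⇒≋one {(k ∷ []) * x} (subst (λ n → Monic n ((k ∷ []) * x)) d M))

  ∣-trans : ∀ {p r s} → p ∣ r → r ∣ s → p ∣ s
  ∣-trans {p} {r} {s} (u ∣-, up≈r) (v ∣-, vr≈s) = v * u ∣-, at (begin
    v * u * p     ≈⟨ R.*-assoc v u p ⟩
    v * (u * p)   ≈⟨ R.*-congˡ {v} (pointwise up≈r) ⟩
    v * r         ≈⟨ pointwise vr≈s ⟩
    s             ∎)
    where open ≋-Reasoning

  ≋⇒∣ : ∀ {p r} → p ≋ r → p ∣ r
  ≋⇒∣ {p} e = one ∣-, at (R.trans (R.*-identityˡ p) e)

  ∣-*ˡ : ∀ p r → p ∣ p * r
  ∣-*ˡ p r = r ∣-, at (R.*-comm r p)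

  -- Membership in `𝓜 (deg p)` fixes the listed representative, so that primes can be compared by
  -- `_≡_` and looked up in lists.
  IsPrime : Poly → Set
  IsPrime p = Irreducible p × p ∈ 𝓜 (deg p)

  IsPrime⁺ : ∀ {n p} → Irreducible p → p ∈ 𝓜 n → IsPrime p
  IsPrime⁺ {n} {p} irr p∈ = irr , subst (λ k → p ∈ 𝓜 k) (sym (proj₁ (𝓜-sound n p∈))) p∈

  IsPrime⇒Monic : ∀ {p} → IsPrime p → Monic (deg p) p
  IsPrime⇒Monic {p} (_ , p∈) = 𝓜-sound (deg p) p∈

  IsPrime⇒0<deg : ∀ {p} → IsPrime p → 0 < deg p
  IsPrime⇒0<deg {p} P@(irr , _) = ℕ.n≢0⇒n>0 λ d → Irreducible.p∤1 irr
    (deg≡0⇒∣1 p (Monic⇒≉0 {p = p} (IsPrime⇒Monic P)) d)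

  prime-∣-prime : ∀ {p r} → IsPrime p → IsPrime r → p ∣ r → p ≡ r
  prime-∣-prime {p} {r} P@(irr-p , p∈) R@(irr-r , r∈) p∣r =
    𝓜-distinct (deg p) p∈ (subst (λ k → r ∈ 𝓜 k) (sym (deg-cong {p} {r} (at p≋r))) r∈) (at p≋r)
    where p≋r = irreducible-monic-divisor irr-p (IsPrime⇒Monic P) irr-r (IsPrime⇒Monic R) p∣r

  -- Strong induction on the degree. A finite search below degree `n` either finds a monic divisor
  -- of positive degree, whose prime divisor serves, or shows that `f` is irreducible.
  prime-divisor : ∀ {n} → Acc _<_ n → 0 < n → ∀ f → Monic n f → ∃[ p ] IsPrime p × p ∣ f
  prime-divisor {n} (acc rs) 0<n f M
    with any? (λ g → 0 ℕ.<? deg g ×-dec g ∣? f) (concatMap 𝓜 (upTo n))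
  ... | yes a with find a
  ...   | g , g∈ , 0<g , g∣f with find (∈-concatMap⁻ 𝓜 {xs = upTo n} g∈)
  ...     | k , k∈ , g∈𝓜 with 𝓜-sound k g∈𝓜
  ...       | G@(refl , _) with prime-divisor (rs (∈-upTo⁻ k∈)) 0<g g G
  ...         | p , P , p∣g = p , P , ∣-trans {p} {g} {f} p∣g g∣f
  prime-divisor {n} (acc rs) 0<n f M@(d , _) | no ¬a with 𝓜-complete n f M
  ... | p , p∈ , p≈f =
    p , IsPrime⁺ {n} (Irreducible-resp {f} {p} (λ i → sym (p≈f i)) (mkIrred f∤1 split)) p∈ ,
    ≋⇒∣ {p} {f} (pointwise p≈f)
    where
    f∤1 : f ∤ one
    f∤1 f∣1 = ℕ.<⇒≢ 0<n (trans (sym (∣1⇒deg≡0 {f} f∣1)) d)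

    -- Scaled to be monic, such an `x` would have been found by the search; the cofactor `y` absorbs
    -- the inverse constant `l`.
    no-factor : ∀ x y → f ≈ x * y → ¬ x ≈ [] → 0 < deg x → ¬ deg x < n
    no-factor x y e x≉0 0<x x<n with monic-associate x x≉0
    ... | k , l , lk≋1 , X with 𝓜-complete (deg x) ((k ∷ []) * x) X
    ...   | g , g∈ , g≈ = ¬a (lose (∈-concatMap⁺ 𝓜 (lose (∈-upTo⁺ x<n) g∈))
              ( subst (0 <_) (sym (proj₁ (𝓜-sound (deg x) g∈))) 0<x
              , ∣-trans {g} {(k ∷ []) * x} {f} (≋⇒∣ {g} {(k ∷ []) * x} (pointwise g≈))
                  (y * (l ∷ []) ∣-, at (begin
                  y * (l ∷ []) * ((k ∷ []) * x)   ≈⟨ R.*-assoc y _ _ ⟩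
                  y * ((l ∷ []) * ((k ∷ []) * x)) ≈⟨ R.*-congˡ {y} (∣-unit (l ∷ []) (k ∷ []) x lk≋1 R.refl) ⟩
                  y * x                           ≈⟨ R.*-comm y x ⟩
                  x * y                           ≈⟨ pointwise e ⟨
                  f                               ∎))))
      where open ≋-Reasoning

    split : ∀ {x y} → f ≈ x * y → x ∣ one ⊎ y ∣ one
    split {x} {y} e = cases (deg x ℕ.≟ 0) (deg y ℕ.≟ 0)
      where
      f≉0 = Monic⇒≉0 {p = f} M
      x≉0 : ¬ x ≈ []
      x≉0 x≈0 = f≉0 λ i → trans (e i) (*-zeroˡ {x} y x≈0 i)
      y≉0 : ¬ y ≈ []
      y≉0 y≈0 = f≉0 λ i → trans (e i) (*-zeroʳ x {y} y≈0 i)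
      deg-sum : deg x ℕ.+ deg y ≡ n
      deg-sum = trans (sym (deg-* x y x≉0 y≉0)) (trans (deg-cong {x * y} {f} (λ i → sym (e i))) d)
      cases : Dec (deg x ≡ 0) → Dec (deg y ≡ 0) → x ∣ one ⊎ y ∣ one
      cases (yes x₀) _        = inj₁ (deg≡0⇒∣1 x x≉0 x₀)
      cases (no _)   (yes y₀) = inj₂ (deg≡0⇒∣1 y y≉0 y₀)
      cases (no 0≢x) (no 0≢y) = contradiction
        (subst (deg x <_) deg-sum (ℕ.m<m+n (deg x) (ℕ.n≢0⇒n>0 0≢y)))
        (no-factor x y e x≉0 (ℕ.n≢0⇒n>0 0≢x))

  ∣-monic⇒deg≤ : ∀ {p f n} → Monic n f → p ∣ f → deg p ≤ n
  ∣-monic⇒deg≤ {p} {f} M@(d , _) p∣f = subst (deg p ≤_) d (∣⇒deg≤ {p} {f} (Monic⇒≉0 {p = f} M) p∣f)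

  ∈-divisors⁺ : ∀ {p f} → ¬ f ≈ [] → IsPrime p → p ∣ f → p ∈ monicIrreducibleDivisors f
  ∈-divisors⁺ {p} {f} f≉0 (irr , p∈) p∣f = ∈-filter⁺ (λ p → irreducible? p ×-dec p ∣? f)
    (∈-concatMap⁺ 𝓜 (lose (∈-upTo⁺ (s≤s (∣⇒deg≤ {p} {f} f≉0 p∣f))) p∈)) (irr , p∣f)

  ∈-divisors⁻ : ∀ {p} f → p ∈ monicIrreducibleDivisors f → IsPrime p × p ∣ f
  ∈-divisors⁻ f p∈ with ∈-filter⁻ (λ p → irreducible? p ×-dec p ∣? f) p∈
  ... | p∈′ , irr , p∣f with find (∈-concatMap⁻ 𝓜 {xs = upTo (suc (deg f))} p∈′)
  ...   | n , _ , p∈𝓜 = IsPrime⁺ {n} irr p∈𝓜 , p∣f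

  -- Smooth polynomials, intervals and Buchstab's step.

  open DecMembership (≡-dec _≟ᶠ_) using (_∈?_)

  -- Smoothness is relative to a list of allowed primes rather than a degree, so that the induction
  -- can admit one prime at a time.
  Smooth : List Poly → Poly → Set
  Smooth L f = All (_∈ L) (monicIrreducibleDivisors f)

  smooth? : ∀ L → Decidable (Smooth L)
  smooth? L f = All.all? (_∈? L) (monicIrreducibleDivisors f)

  Smooth⁺ : ∀ {L} f → (∀ p → IsPrime p → p ∣ f → p ∈ L) → Smooth L f
  Smooth⁺ f h = All.tabulate λ p∈ → let P , p∣f = ∈-divisors⁻ f p∈ in h _ P p∣f

  Smooth⁻ : ∀ {L p f} → ¬ f ≈ [] → Smooth L f → IsPrime p → p ∣ f → p ∈ L
  Smooth⁻ {p = p} {f} f≉0 S P p∣f = All.lookup S (∈-divisors⁺ {p} {f} f≉0 P p∣f)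

  count : List Poly → ℕ → ℕ
  count L m = length (filter (smooth? L) (𝓜 m))

  -- For `f` monic of degree `n` this is its listed form. For other `f` it keeps the `n` lowest
  -- coefficients below a leading 1, which sends an interval of higher degree into `𝓜 n`.
  representative : ℕ → Poly → Poly
  representative n f = truncate n f ++ one

  representative∈𝓜 : ∀ n f → representative n f ∈ 𝓜 n
  representative∈𝓜 n f = ∈-map⁺ (_++ one) (truncate∈tuples n f)

  representative≋ : ∀ {n f} → Monic n f → representative n f ≋ f
  representative≋ {n} {f} M = pointwise (proj₂ (proj₂ (𝓜-complete n f M)))

  coeff-representative : ∀ n f {i} → i < n → coeff (representative n f) i ≡ coeff f i
  coeff-representative (suc n) []      {zero}  _   = refl
  coeff-representative (suc n) []      {suc i} i<n = coeff-representative n [] (ℕ.≤-pred i<n)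
  coeff-representative (suc n) (a ∷ f) {zero}  _   = refl
  coeff-representative (suc n) (a ∷ f) {suc i} i<n = coeff-representative n f (ℕ.≤-pred i<n)

  -- A subset of an interval: distinct polynomials whose differences have degree below m.
  Interval : ℕ → List Poly → Set
  Interval m = AllPairs (λ f g → ¬ f ≋ g × Low m (f - g))

  -- The trivial bound. Members of an interval agree from coefficient `m` on, so their lowest `m`
  -- coefficients tell them apart and `representative m` is injective on them.
  interval-all-smooth : ∀ {m L xs} → (∀ {f} → f ∈ 𝓜 m → Smooth L f) → Interval m xs →
                        length xs ≤ count L m
  interval-all-smooth {m} {L} {xs} all-smooth I = begin
    length xs                             ≡⟨ length-map (representative m) xs ⟨
    length (map (representative m) xs)    ≤⟨ unique-⊆⇒length≤
                                               (AllPairs.map⁺ (AllPairs.map distinct I)) included ⟩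
    count L m                             ∎
    where
    open ℕ.≤-Reasoning
    distinct : ∀ {f g} → ¬ f ≋ g × Low m (f - g) → representative m f ≢ representative m g
    distinct {f} {g} (f≋̸g , low) e = f≋̸g (pointwise agree)
      where
      agree : f ≈ g
      agree i with i ℕ.<? m
      ... | yes i<m = trans (sym (coeff-representative m f i<m))
                        (trans (cong (λ p → coeff p i) e) (coeff-representative m g i<m))
      ... | no  i≮m = RingProperties.x∙y⁻¹≈ε⇒x≈y K.ring _ _
                        (trans (sym (coeff-sub f g i)) (low i (ℕ.≮⇒≥ i≮m)))
    included : map (representative m) xs ⊆ filter (smooth? L) (𝓜 m)
    included p∈ with ∈-map⁻ (representative m) p∈
    ... | f , _ , refl = ∈-filter⁺ (smooth? L) (representative∈𝓜 m f) (all-smooth (representative∈𝓜 m f))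

  -- The direction of Buchstab's identity that bounds `count (p ∷ L)` from below: the `L`-smooth
  -- polynomials and the multiples `p * g` are disjoint, since `p` divides none of the former.
  count-step : ∀ {p L} → IsPrime p → p ∉ L → ∀ n →
               count L (deg p ℕ.+ n) ℕ.+ count (p ∷ L) n ≤ count (p ∷ L) (deg p ℕ.+ n)
  count-step {p} {L} P p∉L n = begin
    length as ℕ.+ length bs               ≡⟨ cong (length as ℕ.+_) (length-map times-p bs) ⟨
    length as ℕ.+ length (map times-p bs) ≡⟨ length-++ as ⟨
    length (as ++ map times-p bs)
      ≤⟨ unique-⊆⇒length≤
           (Unique.++⁺ (Unique.filter⁺ (smooth? L) (𝓜-unique m)) bs-unique disjoint) included ⟩
    count (p ∷ L) m                       ∎
    where
    open ℕ.≤-Reasoning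
    m = deg p ℕ.+ n
    as = filter (smooth? L) (𝓜 m)
    bs = filter (smooth? (p ∷ L)) (𝓜 n)
    times-p : Poly → Poly
    times-p g = representative m (p * g)

    times-p≋ : ∀ {g} → g ∈ 𝓜 n → times-p g ≋ p * g
    times-p≋ {g} g∈ = representative≋ {m} {p * g} (Monic-* {p = p} {g} (IsPrime⇒Monic P) (𝓜-sound n g∈))

    bs⊆𝓜 : All (_∈ 𝓜 n) bs
    bs⊆𝓜 = All.tabulate λ g∈ → proj₁ (∈-filter⁻ (smooth? (p ∷ L)) {xs = 𝓜 n} g∈)

    bs-unique : Unique (map times-p bs)
    bs-unique = AllPairs.map⁺ (AllPairs-map-All
      (λ {f} {g} f∈ g∈ f≢g e → f≢g (𝓜-distinct n f∈ g∈ (at (*-cancelˡ-≋ {p = p} {f} {g} (IsPrime⇒Monic P)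
        (R.trans (R.sym (times-p≋ f∈)) (R.trans (R.reflexive e) (times-p≋ g∈)))))))
      bs⊆𝓜 (Unique.filter⁺ (smooth? (p ∷ L)) (𝓜-unique n)))

    p∣times-p : ∀ {g} → g ∈ 𝓜 n → p ∣ times-p g
    p∣times-p {g} g∈ = ∣-trans {p} {p * g} {times-p g} (∣-*ˡ p g) (≋⇒∣ (R.sym (times-p≋ g∈)))

    disjoint : ∀ {f} → ¬ (f ∈ as × f ∈ map times-p bs)
    disjoint (f∈as , f∈bs) with ∈-map⁻ times-p f∈bs
    ... | g , g∈ , refl with ∈-filter⁻ (smooth? L) {xs = 𝓜 m} f∈as
    ...   | f∈𝓜 , S = p∉L (Smooth⁻ {f = times-p g} (Monic⇒≉0 {p = times-p g} (𝓜-sound m f∈𝓜)) S P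
              (p∣times-p (All.lookup bs⊆𝓜 g∈)))

    included : as ++ map times-p bs ⊆ filter (smooth? (p ∷ L)) (𝓜 m)
    included f∈ with ∈-++⁻ as f∈
    ... | inj₁ f∈as = let f∈𝓜 , S = ∈-filter⁻ (smooth? L) {xs = 𝓜 m} f∈as in
            ∈-filter⁺ (smooth? (p ∷ L)) f∈𝓜 (All.map there S)
    ... | inj₂ f∈bs with ∈-map⁻ times-p f∈bs
    ...   | g , g∈ , refl with ∈-filter⁻ (smooth? (p ∷ L)) {xs = 𝓜 n} g∈
    ...     | g∈𝓜 , S = ∈-filter⁺ (smooth? (p ∷ L)) (representative∈𝓜 m (p * g))
                -- Euclid's lemma: a prime dividing `p * g` divides `p`, and is then `p` itself, or
                -- divides the smooth `g`.
                (Smooth⁺ (times-p g) λ r R r∣f → case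
                  euclid {r} (proj₁ R) (Monic⇒≉0 {p = r} (IsPrime⇒Monic R)) p g
                    (∣-trans {r} {times-p g} {p * g} r∣f (≋⇒∣ (times-p≋ g∈𝓜))) of λ where
                    (inj₁ r∣p) → here (prime-∣-prime R P r∣p)
                    (inj₂ r∣g) → Smooth⁻ {f = g} (Monic⇒≉0 {p = g} (𝓜-sound n g∈𝓜)) S R r∣g)

  -- The induction over primes and interval lengths.

  data Descending : List Poly → Set where
    []  : Descending []
    -- Only strictly smaller degrees must already be present, so primes of equal degree may come in
    -- any order.
    _∷_ : ∀ {p L} → IsPrime p × p ∉ L × (∀ r → IsPrime r → deg r < deg p → r ∈ L) →
          Descending L → Descending (p ∷ L)

  -- The default `[]` is never met in the count: `quotient p` is mapped only over polynomials that
  -- `p` divides.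
  quotient : Poly → Poly → Poly
  quotient p f with p ∣? f
  ... | yes (g ∣-, _) = g
  ... | no _          = []

  quotient-* : ∀ p f → p ∣ f → quotient p f * p ≋ f
  quotient-* p f p∣f with p ∣? f
  ... | yes (g ∣-, e) = pointwise e
  ... | no ¬p∣f       = contradiction p∣f ¬p∣f

  -- Since `f - g` is `p` times the difference of the quotients, the degree bound drops by `deg p`;
  -- equal quotients would force `f` and `g` to be equal.
  interval-quotient : ∀ {p n f g} → IsPrime p → p ∣ f → p ∣ g →
    ¬ f ≋ g × Low (deg p ℕ.+ n) (f - g) →
    ¬ quotient p f ≋ quotient p g × Low n (quotient p f - quotient p g)
  interval-quotient {p} {n} {f} {g} P p∣f p∣g (f≋̸g , low) =
    (λ e → f≋̸g (R.trans (R.sym fq) (R.trans (R.*-congʳ {p} e) gq))) ,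
    Low-quotient {p = p} (f/p - g/p) n (IsPrime⇒Monic P) (Low-resp (begin
      f - g                   ≈⟨ R.+-cong fq (R.-‿cong gq) ⟨
      f/p * p - g/p * p       ≈⟨ RP.[y-z]x≈yx-zx p f/p g/p ⟨
      (f/p - g/p) * p         ≈⟨ R.*-comm (f/p - g/p) p ⟩
      p * (f/p - g/p)         ∎) low)
    where
    open ≋-Reasoning
    f/p = quotient p f
    g/p = quotient p g
    fq = quotient-* p f p∣f
    gq = quotient-* p g p∣g

  smooth-quotient : ∀ {p N f L} → IsPrime p → p ∣ f → Monic (N ℕ.+ deg p) f → Smooth L f →
                    Monic N (quotient p f) × Smooth L (quotient p f)
  smooth-quotient {p} {N} {f} P p∣f M S =
    Monic-quotient {p = quotient p f} {p}
      (Monic-resp {r = quotient p f * p} (R.sym fq) M) (IsPrime⇒Monic P) ,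
    Smooth⁺ (quotient p f) λ r R r∣ → Smooth⁻ {f = f} (Monic⇒≉0 {p = f} M) S R
      (∣-trans {r} {quotient p f} {f} r∣
        (∣-trans {quotient p f} {quotient p f * p} {f} (∣-*ˡ (quotient p f) p) (≋⇒∣ fq)))
    where fq = quotient-* p f p∣f

  -- If `p` did not divide `f`, every prime divisor of `f` would lie in the tail `L`.
  smooth-new⇒∣ : ∀ {p f L} → Smooth (p ∷ L) f → ¬ Smooth L f → p ∣ f
  smooth-new⇒∣ {p} {f} {L} S ¬S with p ∣? f
  ... | yes p∣f = p∣f
  ... | no ¬p∣f = contradiction (All.tabulate λ {r} r∈ → case All.lookup S r∈ of λ where
    (here refl)  → contradiction (proj₂ (∈-divisors⁻ f r∈)) ¬p∣f
    (there r∈L)  → r∈L) ¬S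

  -- The degree `N` and the length exponent `m` vary separately, as division by `p` lowers both. The
  -- condition `m ≤ N` excludes the list consisting of 1 alone with `m > 0`, where `count [] m` is
  -- 0.
  IntervalBound : List Poly → Set
  IntervalBound L = ∀ N m → m ≤ N → ∀ xs → Interval m xs →
    All (λ f → Monic N f × Smooth L f) xs → length xs ≤ count L m

  interval-bound-[] : IntervalBound []
  interval-bound-[] N       m    _   []          I A = z≤n
  -- Here `m ≤ N` forces `m` to be 0, and the constant 1 is smooth over the empty list.
  interval-bound-[] zero    zero _   (_ ∷ _)     I A = interval-all-smooth (λ {f} f∈ →
    Smooth⁺ f λ p P p∣f → contradiction
      (ℕ.<-≤-trans (IsPrime⇒0<deg P) (∣-monic⇒deg≤ {p} {f} (𝓜-sound 0 f∈) p∣f)) λ ()) I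
  -- In positive degree a prime divisor exists and would have to lie in `[]`.
  interval-bound-[] (suc N) m    _   (f ∷ xs)    I ((M , S) ∷ A)
    with prime-divisor (<-wellFounded (suc N)) z<s f M
  ... | p , P , p∣f with Smooth⁻ {p = p} {f} (Monic⇒≉0 {p = f} M) S P p∣f
  ...   | ()

  -- Members already `L`-smooth fall under `bound`; the others are divisible by `p` and their
  -- quotients fall under the recursion on `m`. `count-step` recombines the two counts.
  interval-bound-∷ : ∀ {p L} → IsPrime p → p ∉ L → (∀ r → IsPrime r → deg r < deg p → r ∈ L) →
                     IntervalBound L → ∀ {m} → Acc _<_ m → ∀ N → m ≤ N → ∀ xs → Interval m xs →
                     All (λ f → Monic N f × Smooth (p ∷ L) f) xs → length xs ≤ count (p ∷ L) m
  interval-bound-∷ {p} {L} P p∉L smaller bound {m} (acc rs) N m≤N xs I A with deg p ℕ.≤? m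
  -- A prime dividing a polynomial of degree `m < deg p` is among the `smaller` ones, so all of
  -- `𝓜 m` is counted.
  ... | no p≰m = interval-all-smooth (λ {f} f∈ → Smooth⁺ f λ r R r∣f →
          there (smaller r R (ℕ.≤-<-trans (∣-monic⇒deg≤ {r} {f} (𝓜-sound m f∈) r∣f) (ℕ.≰⇒> p≰m)))) I
  ... | yes p≤m with ℕ.m≤n⇒∃[o]m+o≡n p≤m | ℕ.m≤n⇒∃[o]m+o≡n (ℕ.≤-trans p≤m m≤N)
  ...   | n , refl | N′ , refl = begin
    length xs                                     ≡⟨ length-filter-split (smooth? L) xs ⟩
    length old ℕ.+ length new                     ≡⟨ cong (length old ℕ.+_) (length-map (quotient p) new) ⟨
    length old ℕ.+ length (map (quotient p) new)  ≤⟨ ℕ.+-mono-≤ old-bound new-bound ⟩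
    count L m ℕ.+ count (p ∷ L) n                 ≤⟨ count-step P p∉L n ⟩
    count (p ∷ L) m                               ∎
    where
    open ℕ.≤-Reasoning
    old = filter (smooth? L) xs
    new = filter (¬? ∘ smooth? L) xs

    old-bound : length old ≤ count L m
    old-bound = bound N m m≤N old (AllPairs.filter⁺ (smooth? L) I)
      (All.tabulate λ f∈ → let f∈xs , S = ∈-filter⁻ (smooth? L) {xs = xs} f∈ in
        proj₁ (All.lookup A f∈xs) , S)

    new-∣ : All (p ∣_) new
    new-∣ = All.tabulate λ f∈ → let f∈xs , ¬S = ∈-filter⁻ (¬? ∘ smooth? L) {xs = xs} f∈ in
      smooth-new⇒∣ (proj₂ (All.lookup A f∈xs)) ¬S

    new-bound : length (map (quotient p) new) ≤ count (p ∷ L) n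
    -- The list stays `p ∷ L`, since a quotient may again be divisible by `p`. Both `m` and `N` drop
    -- by `deg p > 0`, which preserves `m ≤ N`.
    new-bound = interval-bound-∷ P p∉L smaller bound (rs (ℕ.m<n+m n (IsPrime⇒0<deg P))) N′
      (ℕ.+-cancelˡ-≤ (deg p) n N′ m≤N) (map (quotient p) new)
      (AllPairs.map⁺ (AllPairs-map-All (interval-quotient P) new-∣
        (AllPairs.filter⁺ (¬? ∘ smooth? L) I)))
      (All.map⁺ (All.tabulate λ {f} f∈ →
        let M , S = All.lookup A (proj₁ (∈-filter⁻ (¬? ∘ smooth? L) {xs = xs} f∈)) in
        smooth-quotient P (All.lookup new-∣ f∈)
          (subst (λ k → Monic k f) (ℕ.+-comm (deg p) N′) M) S))

  interval-bound : ∀ {L} → Descending L → IntervalBound L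
  interval-bound []                            = interval-bound-[]
  interval-bound ((P , p∉L , smaller) ∷ D) N m =
    interval-bound-∷ P p∉L smaller (interval-bound D) (<-wellFounded m) N

  -- The primes ordered by degree.

  primesBelow : ℕ → List Poly
  primesBelow zero    = []
  -- The highest degree comes in front, as `Descending` demands.
  primesBelow (suc k) = filter irreducible? (𝓜 k) ++ primesBelow k

  ∈-primesBelow⁺ : ∀ {p} k → IsPrime p → deg p < k → p ∈ primesBelow k
  ∈-primesBelow⁺ (suc k) P@(irr , p∈) lt with ℕ.m≤n⇒m<n∨m≡n (ℕ.≤-pred lt)
  ... | inj₁ p<k  = ∈-++⁺ʳ _ (∈-primesBelow⁺ k P p<k)
  ... | inj₂ refl = ∈-++⁺ˡ (∈-filter⁺ irreducible? p∈ irr)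

  ∈-primesBelow⁻ : ∀ {p} k → p ∈ primesBelow k → deg p < k
  ∈-primesBelow⁻ (suc k) p∈ with ∈-++⁻ (filter irreducible? (𝓜 k)) p∈
  ... | inj₁ p∈k = s≤s (ℕ.≤-reflexive (proj₁ (𝓜-sound k (proj₁ (∈-filter⁻ irreducible? p∈k)))))
  ... | inj₂ p∈< = ℕ.m<n⇒m<1+n (∈-primesBelow⁻ k p∈<)

  -- Stated for any list of distinct primes of degree `k`, so that they can be added singly; the
  -- smaller primes each one requires are all in `primesBelow k`.
  primesBelow-extend : ∀ {k} ps → Unique ps → All (λ p → IsPrime p × deg p ≡ k) ps →
                       Descending (primesBelow k) → Descending (ps ++ primesBelow k)
  primesBelow-extend []       _            _                 D = D
  primesBelow-extend {k} (p ∷ ps) (p∉ps ∷ ps!) ((P , refl) ∷ Ps) D =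
    ( P
    , (λ p∈ → case ∈-++⁻ ps p∈ of λ where
        (inj₁ p∈ps) → All.lookup p∉ps p∈ps refl
        (inj₂ p∈<)  → ℕ.<-irrefl refl (∈-primesBelow⁻ k p∈<))
    , λ r R r<k → ∈-++⁺ʳ ps (∈-primesBelow⁺ k R r<k)) ∷ primesBelow-extend ps ps! Ps D

  primesBelow-descending : ∀ k → Descending (primesBelow k)
  primesBelow-descending zero    = []
  primesBelow-descending (suc k) = primesBelow-extend (filter irreducible? (𝓜 k))
    (Unique.filter⁺ irreducible? (𝓜-unique k))
    (All.tabulate λ p∈ → let p∈𝓜 , irr = ∈-filter⁻ irreducible? {xs = 𝓜 k} p∈ in
      IsPrime⁺ {k} irr p∈𝓜 , proj₁ (𝓜-sound k p∈𝓜))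
    (primesBelow-descending k)

  -- Translation of the degree conditions.

  P⁺≤⇒Smooth : ∀ {d} f → P⁺ f ≤ d → Smooth (primesBelow (suc d)) f
  P⁺≤⇒Smooth f P⁺≤d = All.tabulate λ p∈ → ∈-primesBelow⁺ _ (proj₁ (∈-divisors⁻ f p∈))
    (s≤s (ℕ.≤-trans (All.lookup (xs≤max 0 _) (∈-map⁺ deg p∈)) P⁺≤d))

  Smooth⇒P⁺≤ : ∀ {d} f → Smooth (primesBelow (suc d)) f → P⁺ f ≤ d
  Smooth⇒P⁺≤ f S = max≤v⁺ z≤n (All.map⁺ (All.map (ℕ.≤-pred ∘ ∈-primesBelow⁻ _) S))

  -- Both agree with the centre `a` from coefficient `n` on. The resulting pairwise condition
  -- survives division by `p`, even when `p` does not divide `a`.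
  Low-interval : ∀ {n a f g} → Low n (f - a) → Low n (g - a) → Low n (f - g)
  Low-interval {n} {a} {f} {g} F G i n≤i = trans (coeff-sub f g i)
    (trans (cong (_+ᶠ _) (trans (agree f F) (sym (agree g G)))) (K.-‿inverseʳ _))
    where
    agree : ∀ f → Low n (f - a) → coeff f i ≡ coeff a i
    agree f F = RingProperties.x∙y⁻¹≈ε⇒x≈y K.ring _ _ (trans (sym (coeff-sub f a i)) (F i n≤i))

proposition2p5 : ∀ (q : ℕ) → IsPrimePower q →
    ∀ (𝔽 : FiniteField q) → let open Polynomials 𝔽 in
    ∀ (N : ℕ) → 2 ≤ N →
    ∀ (A : Poly) → Monic N A →
    ∀ (h d : ℕ) → h ≤ N ∸ 1 →
    length (filter (λ F → deg (F - A) ℕ.≤? h ×-dec P⁺ F ℕ.≤? d) (𝓜 N))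
    ≤ length (filter (λ F → P⁺ F ℕ.≤? d) (𝓜 (suc h)))
proposition2p5 q _ 𝔽 (suc N) _ A _ h d h≤N = begin
  length xs
    -- Both bounds shift by one: `primesBelow` is strict, so `P⁺ F ≤ d` calls for `suc d`, and
    -- differences of degree at most `h` are `Low (suc h)`.
    ≤⟨ interval-bound (primesBelow-descending (suc d)) (suc N) (suc h) (s≤s h≤N) xs interval
         (All.map (λ { {F} (F∈ , _ , smooth) → 𝓜-sound (suc N) F∈ , P⁺≤⇒Smooth F smooth }) xs-spec) ⟩
  count (primesBelow (suc d)) (suc h)
    ≡⟨ cong length (filter-≐ (smooth? _) (λ F → P⁺ F ℕ.≤? d)
         ((λ {F} → Smooth⇒P⁺≤ F) , (λ {F} → P⁺≤⇒Smooth F)) (𝓜 (suc h))) ⟩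
  length (filter (λ F → P⁺ F ℕ.≤? d) (𝓜 (suc h))) ∎
  where
  open ℕ.≤-Reasoning
  open Polynomials 𝔽
  open PolynomialRing 𝔽
  open PolynomialArithmetic 𝔽
  open Smoothness 𝔽
  inInterval? = λ F → deg (F - A) ℕ.≤? h ×-dec P⁺ F ℕ.≤? d
  xs = filter inInterval? (𝓜 (suc N))
  xs-spec : All (λ F → F ∈ 𝓜 (suc N) × deg (F - A) ≤ h × P⁺ F ≤ d) xs
  xs-spec = All.tabulate (∈-filter⁻ inInterval?)
  interval : Interval (suc h) xs
  interval = AllPairs-map-All
    (λ {F} {G} (F∈ , dF , _) (G∈ , dG , _) F≢G →
      F≢G ∘ 𝓜-distinct (suc N) F∈ G∈ ∘ at ,
      Low-interval {a = A} {F} {G} (deg<⇒Low (F - A) (s≤s dF)) (deg<⇒Low (G - A) (s≤s dG)))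
    xs-spec (Unique.filter⁺ inInterval? (𝓜-unique (suc N)))
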